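{- Let $\mathcal{Z}$ be a finite zero-set, and let $a$ and $b$ be the sizes of the longest row and the longest column of $\mathcal{Z}$, respectively. If $m,n\in\mathbb{N}$ satisfy $m,n>ab$, then $$\gamma^2(\mathcal{Z},m,n)=\min(bx+ay-xy),$$ where the minimum is over all concave corners $(x,y)$ of $\mathcal{Z}$.
   Context: $\mathbb{Z}_+=\{0,1,2,\dots\}$, $\mathbb{N}=\{1,2,\dots\}$, $[0,c]=\{0,\dots,c\}$, $R_{n,m}=[0,n-1]\times[0,m-1]$. A zero-set (Young diagram) is a downward-closed set $\mathcal{Z}\subseteq\mathbb{Z}_+^2$; its rows are the sets of its points with a given second coordinate, its columns the sets of its points with a given first coordinate (so $a=|\{x\colon(x,0)\in\mathcal{Z}\}|$ and $b=|\{y\colon(0,y)\in\mathcal{Z}\}|$). A concave corner of $\mathcal{Z}$ is a minimal point of $\mathbb{Z}_+^2\setminus\mathcal{Z}$ in the coordinatewise partial order. The graph $K_m\Box K_n$ is represented on the vertex set $R_{n,m}$, with two vertices adjacent iff they differ in exactly one coordinate. For $v=(j,i)\in R_{n,m}$, $\mathcal{N}^r(v)$ is the set of all $(j',i)\in R_{n,m}$ with $j'\ne j$ and $\mathcal{N}^c(v)$ the set of all $(j,i')\in R_{n,m}$ with $i'\neq i$. For $A\subseteq R_{n,m}$ let $\mathcal{T}(A)=A\cup\{v\in R_{n,m}\setminus A\colon(|\mathcal{N}^r(v)\cap A|,|\mathcal{N}^c(v)\cap A|)\notin\mathcal{Z}\}$. Then $\gamma^2(\mathcal{Z},m,n)=\min\{|A|\colon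 A\subseteq R_{n,m},\ \mathcal{T}(\mathcal{T}(A))=R_{n,m}\}$. -}

module Defs where

open import Data.Fin using (Fin)
import Data.Fin.Properties as Fin
open import Data.Fin.Subset as Subset using (Subset)
import Data.Fin.Subset.Properties as Subset
open import Data.List using (List; length)
open import Data.List.Membership.Propositional using () renaming (_∈_ to _∈ₗ_)
open import Data.List.Relation.Unary.Unique.Propositional using (Unique)
open import Data.Nat using (ℕ; zero; suc; _≤_; _<_; s≤s)
import Data.Nat.Properties as ℕ
open import Data.Product using (∃; ∃-syntax; _×_; _,_; proj₁)
open import Data.Product.Relation.Binary.Pointwise.NonDependent using (Pointwise)
open import Data.Sum using (_⊎_; inj₁; inj₂)
open import Data.Vec using (Vec; []; _∷_; lookup; tabulate; zipWith; replicate; map; sum)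
import Data.Vec.Properties as Vec
open import Function using (_⇔_)
open import Level using (0ℓ)
open import Relation.Binary.PropositionalEquality
  using (_≡_; refl; sym; subst)
open import Relation.Nullary using (¬_; Dec; yes; no; does)
open import Relation.Nullary.Decidable using (map′; _×-dec_; ¬?)
open import Relation.Nullary.Negation using (contradiction)
open import Relation.Unary using (Pred; Decidable)

------------------------------------------------------------------------
-- Minima, maxima and cardinalities

IsMinimum : Pred ℕ 0ℓ → Pred ℕ 0ℓ
IsMinimum P k = P k × (∀ l → P l → k ≤ l)

IsMaximum : Pred ℕ 0ℓ → Pred ℕ 0ℓ
IsMaximum P k = P k × (∀ l → P l → l ≤ k)

Finite : {A : Set} → Pred A 0ℓ → Set
Finite P = ∃[ xs ] (∀ x → x ∈ₗ xs ⇔ P x)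

HasSize : {A : Set} → Pred A 0ℓ → ℕ → Set
HasSize P k = ∃[ xs ] Unique xs × (∀ x → x ∈ₗ xs ⇔ P x) × length xs ≡ k

minimum : {P : Pred ℕ 0ℓ} → Decidable P → ∃ P → ∃ (IsMinimum P)
minimum {P} P? (k , pk) with search (suc k)
  where
  search : ∀ k → ∃ (IsMinimum P) ⊎ (∀ {l} → l < k → ¬ P l)
  search zero = inj₂ λ ()
  search (suc k) with search k
  ... | inj₁ found = inj₁ found
  ... | inj₂ none with P? k
  ...   | yes pk = inj₁ (k , pk , λ l pl → ℕ.≮⇒≥ λ l<k → none l<k pl)
  ...   | no ¬pk = inj₂ λ { {l} (s≤s l≤k) pl → below l l≤k pl }
    where
    below : ∀ l → l ≤ k → ¬ P l
    below l l≤k pl with ℕ.m≤n⇒m<n∨m≡n l≤k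
    ... | inj₁ l<k  = none l<k pl
    ... | inj₂ refl = ¬pk pl
... | inj₁ found = found
... | inj₂ none  = contradiction pk (none ℕ.≤-refl)

------------------------------------------------------------------------
-- Zero-sets

_≤²_ : ℕ × ℕ → ℕ × ℕ → Set
_≤²_ = Pointwise _≤_ _≤_

-- Membership is required to be decidable, so that the transformation 𝒯
-- below maps vertex sets to vertex sets. For a zero-set that is `Finite`
-- this is no restriction, since equality on ℕ × ℕ is decidable.
record ZeroSet : Set₁ where
  field
    Member     : Pred (ℕ × ℕ) 0ℓ
    member?    : Decidable Member
    downClosed : ∀ {p q} → p ≤² q → Member q → Member p

open ZeroSet public

-- Rows and columns are recorded through the coordinate that varies.
row : ZeroSet → ℕ → Pred ℕ 0ℓ
row Z y x = Member Z (x , y)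

column : ZeroSet → ℕ → Pred ℕ 0ℓ
column Z x y = Member Z (x , y)

LongestRowSize : ZeroSet → ℕ → Set
LongestRowSize Z = IsMaximum λ k → ∃[ y ] HasSize (row Z y) k

LongestColumnSize : ZeroSet → ℕ → Set
LongestColumnSize Z = IsMaximum λ k → ∃[ x ] HasSize (column Z x) k

ConcaveCorner : ZeroSet → Pred (ℕ × ℕ) 0ℓ
ConcaveCorner Z p = ¬ Member Z p × (∀ q → ¬ Member Z q → q ≤² p → q ≡ p)

------------------------------------------------------------------------
-- Sets of vertices of R n m = [0,n-1] × [0,m-1]

R : ℕ → ℕ → Set
R n m = Fin n × Fin m

-- Entry i of the vector is the set of all j such that (j , i) is in the
-- vertex set.
VertexSet : ℕ → ℕ → Set
VertexSet n m = Vec (Subset n) m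

module _ {n m : ℕ} where

  infix 4 _∈_ _∈?_
  infixr 7 _∩_
  infixr 6 _∪_

  _∈_ : R n m → VertexSet n m → Set
  (j , i) ∈ A = j Subset.∈ lookup A i

  _∈?_ : ∀ v A → Dec (v ∈ A)
  (j , i) ∈? A = j Subset.∈? lookup A i

  _∩_ _∪_ : VertexSet n m → VertexSet n m → VertexSet n m
  _∩_ = zipWith Subset._∩_
  _∪_ = zipWith Subset._∪_

  ∣_∣ : VertexSet n m → ℕ
  ∣ A ∣ = sum (map Subset.∣_∣ A)

  -- The vertex set { v | P v }.
  ⟦_⟧ : {P : Pred (R n m) 0ℓ} → Decidable P → VertexSet n m
  ⟦ P? ⟧ = tabulate λ i → tabulate λ j → does (P? (j , i))

  𝒩ʳ : R n m → VertexSet n m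
  𝒩ʳ (j , i) = ⟦ (λ (j′ , i′) → ¬? (j′ Fin.≟ j) ×-dec (i′ Fin.≟ i)) ⟧

  𝒩ᶜ : R n m → VertexSet n m
  𝒩ᶜ (j , i) = ⟦ (λ (j′ , i′) → (j′ Fin.≟ j) ×-dec ¬? (i′ Fin.≟ i)) ⟧

  𝒯 : ZeroSet → VertexSet n m → VertexSet n m
  𝒯 Z A = A ∪ ⟦ (λ v → ¬? (v ∈? A) ×-dec
                       ¬? (member? Z (∣ 𝒩ʳ v ∩ A ∣ , ∣ 𝒩ᶜ v ∩ A ∣))) ⟧

  SpansInTwoSteps : ZeroSet → VertexSet n m → Set
  SpansInTwoSteps Z A = ∀ v → v ∈ 𝒯 Z (𝒯 Z A)

------------------------------------------------------------------------
-- γ²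

SpanningSize : ZeroSet → (m n : ℕ) → Pred ℕ 0ℓ
SpanningSize Z m n k = ∃[ A ] SpansInTwoSteps {n} {m} Z A × ∣ A ∣ ≡ k

anyVertexSet? : ∀ {n m} {P : Pred (VertexSet n m) 0ℓ} → Decidable P → Dec (∃ P)
anyVertexSet? {m = zero}  P? = map′ ([] ,_) (λ { ([] , p) → p }) (P? [])
anyVertexSet? {m = suc m} P? =
  map′ (λ { (r , A , p) → r ∷ A , p }) (λ { (r ∷ A , p) → r , A , p })
       (Subset.anySubset? λ r → anyVertexSet? λ A → P? (r ∷ A))

spansInTwoSteps? : ∀ {n m} Z → Decidable (SpansInTwoSteps {n} {m} Z)
spansInTwoSteps? Z A =
  map′ (λ f (j , i) → f i j) (λ f i j → f (j , i))
       (Fin.all? λ i → Fin.all? λ j → (j , i) ∈? 𝒯 Z (𝒯 Z A))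

spanningSize? : ∀ Z m n → Decidable (SpanningSize Z m n)
spanningSize? Z m n k =
  anyVertexSet? λ A → spansInTwoSteps? {n} {m} Z A ×-dec (∣ A ∣ ℕ.≟ k)

∈-∪ˡ : ∀ {n m} (A B : VertexSet n m) v → v ∈ A → v ∈ A ∪ B
∈-∪ˡ A B (j , i) v∈A =
  subst (j Subset.∈_) (sym (Vec.lookup-zipWith Subset._∪_ i A B))
        (Subset.x∈p∪q⁺ (inj₁ v∈A))

𝒯-increasing : ∀ {n m} Z (A : VertexSet n m) v → v ∈ A → v ∈ 𝒯 Z A
𝒯-increasing Z A v = ∈-∪ˡ A _ v

full : ∀ n m → VertexSet n m
full n m = replicate m Subset.⊤

fullSpans : ∀ n m Z → SpansInTwoSteps Z (full n m)
fullSpans n m Z v@(j , i) =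
  𝒯-increasing Z (𝒯 Z (full n m)) v (𝒯-increasing Z (full n m) v
    (subst (j Subset.∈_) (sym (Vec.lookup-replicate i Subset.⊤)) Subset.∈⊤))

γ²-minimum : ∀ Z m n → ∃ (IsMinimum (SpanningSize Z m n))
γ²-minimum Z m n =
  minimum (spanningSize? Z m n) (∣ full n m ∣ , full n m , fullSpans n m Z , refl)

γ² : ZeroSet → (m n : ℕ) → ℕ
γ² Z m n = proj₁ (γ²-minimum Z m n)

-- For the upper bound, a corner (x , y) is realised by [0,x) × [0,b) ∪ [0,a) × [0,y):
-- the first step fills x columns and y rows, and these fill everything in the second.
-- For the lower bound, a spanning A with |A| ≤ ab misses some row and some column.
-- The vertex where they cross is reached only if (X , Y) ∉ Z, where X is the number
-- of columns with at least b points of A and Y the number of rows with at least a.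
-- Take a corner (x , y) ≤ (X , Y); x of these columns and y of these rows contain at
-- least bx + ay − xy points of A.
module Submission where

open import Defs
open import Data.Bool using (true; false)
open import Data.Fin using (Fin; zero; suc; toℕ)
import Data.Fin.Properties as Fin
import Data.Fin.Subset as Subset
import Data.Fin.Subset.Properties as Subset
open import Data.List using (upTo)
import Data.List as List
open import Data.List.Extrema.Nat using (max; xs≤max)
import Data.List.Membership.Propositional.Properties as List
open import Data.List.Membership.Propositional.Properties.WithK using (unique∧set⇒bag)
import Data.List.Properties as List
open import Data.List.Relation.Binary.BagAndSetEquality using (∼bag⇒↭)
open import Data.List.Relation.Binary.Permutation.Propositional.Properties using (↭-length)
import Data.List.Relation.Unary.All as All
import Data.List.Relation.Unary.Unique.Propositional.Properties as Unique
open import Data.Nat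
open import Data.Nat.Properties
open import Algebra.Properties.Semiring.Sum +-*-semiring
  using (sum-syntax; sum-cong-≗; sum-replicate-zero; ∑-distrib-+; ∑-comm;
         *-distribˡ-sum; *-distribʳ-sum)
  renaming (sum to ∑)
open import Data.Product using (∃-syntax; _×_; _,_; proj₁; proj₂)
import Data.Product as Product
open import Data.Sum using (_⊎_; inj₁; inj₂)
open import Data.Vec using ([]; _∷_; lookup; there)
import Data.Vec.Properties as Vec
open import Function using (_⇔_; mk⇔; Equivalence; id; _∘_; case_of_)
open import Function.Construct.Composition using (_⇔-∘_)
open import Function.Construct.Symmetry using (⇔-sym)
open import Level using (0ℓ)
open import Relation.Binary.PropositionalEquality
open import Relation.Nullary using (¬_; Dec; yes; no; does; contradiction)
open import Relation.Nullary.Decidable using (_×-dec_; _⊎-dec_; ¬?; decidable-stable; dec-true)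
open import Relation.Unary using (Pred; Decidable)

open Equivalence using (to; from)

private variable
  k l m n : ℕ
  P Q : Set

-- Indicators and finite sums

ι : Dec P → ℕ
ι (yes _) = 1
ι (no _)  = 0

ι-mono : (p : Dec P) (q : Dec Q) → (P → Q) → ι p ≤ ι q
ι-mono (yes p) (yes _) f = ≤-refl
ι-mono (yes p) (no ¬q) f = contradiction (f p) ¬q
ι-mono (no _)  _       f = z≤n

ι-cong : (p : Dec P) (q : Dec Q) → P ⇔ Q → ι p ≡ ι q
ι-cong p q e = ≤-antisym (ι-mono p q (to e)) (ι-mono q p (from e))

ι≤1 : (p : Dec P) → ι p ≤ 1
ι≤1 (yes _) = ≤-refl
ι≤1 (no _)  = z≤n

ι-no : (p : Dec P) → ¬ P → ι p ≡ 0
ι-no (yes p) ¬p = contradiction p ¬p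
ι-no (no _)  ¬p = refl

ι≡0⇒¬ : (p : Dec P) → ι p ≡ 0 → ¬ P
ι≡0⇒¬ (no ¬p) _ = ¬p

ι-× : (p : Dec P) (q : Dec Q) → ι (p ×-dec q) ≡ ι p * ι q
ι-× (yes _) (yes _) = refl
ι-× (yes _) (no _)  = refl
ι-× (no _)  _       = refl

-- Inclusion-exclusion for two events; summed over the grid, it measures a union of two rectangles.
ι-⊎-× : (p : Dec P) (q : Dec Q) → ι (p ⊎-dec q) + ι (p ×-dec q) ≡ ι p + ι q
ι-⊎-× (yes _) (yes _) = refl
ι-⊎-× (yes _) (no _)  = refl
ι-⊎-× (no _)  (yes _) = refl
ι-⊎-× (no _)  (no _)  = refl

∑-mono : {f g : Fin n → ℕ} → (∀ i → f i ≤ g i) → ∑ f ≤ ∑ g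
∑-mono {zero}  f≤g = z≤n
∑-mono {suc n} f≤g = +-mono-≤ (f≤g zero) (∑-mono (f≤g ∘ suc))

∑-mono₂ : {f g : Fin m → Fin n → ℕ} → (∀ i j → f i j ≤ g i j) →
          ∑[ i < m ] ∑[ j < n ] f i j ≤ ∑[ i < m ] ∑[ j < n ] g i j
∑-mono₂ f≤g = ∑-mono λ i → ∑-mono (f≤g i)

∑-zero : (f : Fin n → ℕ) → (∀ i → f i ≡ 0) → ∑ f ≡ 0
∑-zero {n} f f≡0 = trans (sum-cong-≗ f≡0) (sum-replicate-zero n)

∑≡0⇒≡0 : (f : Fin n → ℕ) → ∑ f ≡ 0 → ∀ i → f i ≡ 0
∑≡0⇒≡0 f ∑≡0 zero    = m+n≡0⇒m≡0 (f zero) ∑≡0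
∑≡0⇒≡0 f ∑≡0 (suc i) = ∑≡0⇒≡0 (f ∘ suc) (m+n≡0⇒n≡0 (f zero) ∑≡0) i

∑-single : (f : Fin n → ℕ) (i : Fin n) → (∀ j → j ≢ i → f j ≡ 0) → ∑ f ≡ f i
∑-single f zero    f≡0 =
  trans (cong (f zero +_) (∑-zero (f ∘ suc) λ j → f≡0 (suc j) λ ())) (+-identityʳ _)
∑-single f (suc i) f≡0 =
  cong₂ _+_ (f≡0 zero λ ()) (∑-single (f ∘ suc) i λ j j≢i → f≡0 (suc j) (j≢i ∘ Fin.suc-injective))

-- Pigeonhole: n positive terms would add up to at least n. This yields an empty row and an empty
-- column of a small set.
∑<n⇒∃≡0 : (f : Fin n → ℕ) → ∑ f < n → ∃[ i ] f i ≡ 0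
∑<n⇒∃≡0 {suc n} f ∑<n with f zero in eq
... | zero  = zero , eq
... | suc _ = Product.map suc id
                (∑<n⇒∃≡0 (f ∘ suc) (≤-<-trans (m≤n+m _ _) (s<s⁻¹ ∑<n)))

-- Greedy choice: the first entry takes as much of `k` as `f` allows, and the rest takes the
-- remainder `k ∸ f zero`. Applied to indicators, it selects exactly `k` of the indices.
∑-lower : (f : Fin n → ℕ) → k ≤ ∑ f → ∃[ g ] (∀ i → g i ≤ f i) × ∑ g ≡ k
∑-lower {zero}  f z≤n = f , (λ ()) , refl
∑-lower {suc n} {k} f k≤∑ =
  let g , g≤f , ∑g = ∑-lower (f ∘ suc) (m≤n+o⇒m∸n≤o k (f zero) k≤∑)
  in (λ { zero → k ⊓ f zero ; (suc i) → g i })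
   , (λ { zero → m⊓n≤n k _ ; (suc i) → g≤f i })
   , trans (cong (k ⊓ f zero +_) ∑g)
       (trans (cong (_+ (k ∸ f zero)) (⊓-comm k (f zero))) (m⊓n+n∸m≡n (f zero) k))

∑-* : (f : Fin m → ℕ) (g : Fin n → ℕ) →
      ∑[ i < m ] ∑[ j < n ] (f i * g j) ≡ ∑ f * ∑ g
∑-* {m} f g = trans (sum-cong-≗ {m} λ i → sym (*-distribˡ-sum (f i) g))
                    (sym (*-distribʳ-sum (∑ g) f))

∑∑-+ : (f g : Fin m → Fin n → ℕ) →
       ∑[ i < m ] ∑[ j < n ] (f i j + g i j)
       ≡ ∑[ i < m ] ∑[ j < n ] f i j + ∑[ i < m ] ∑[ j < n ] g i j
∑∑-+ {m} f g = trans (sum-cong-≗ {m} λ i → ∑-distrib-+ (f i) (g i))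
                     (∑-distrib-+ (λ i → ∑ (f i)) (λ i → ∑ (g i)))

∑-ι-< : k ≤ n → ∑[ i < n ] ι (toℕ i <? k) ≡ k
∑-ι-< {zero} {n} z≤n = ∑-zero {n} _ λ i → ι-no (toℕ i <? 0) λ ()
∑-ι-< {suc k} {suc n} (s≤s k≤n) =
  cong suc (trans (sum-cong-≗ {n} λ i → ι-cong (suc (toℕ i) <? suc k) (toℕ i <? k) (mk⇔ s<s⁻¹ s<s))
                  (∑-ι-< k≤n))

-- Vertex sets

∑-ι-∈ : (p : Subset.Subset n) → ∑[ j < n ] ι (j Subset.∈? p) ≡ Subset.∣ p ∣
∑-ι-∈ [] = refl
∑-ι-∈ {suc n} (s ∷ p) =
  trans (cong (ι (zero Subset.∈? (s ∷ p)) +_) (trans (sum-cong-≗ {n} rest)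
                                                      (∑-ι-∈ p)))
        (first s)
  where
  rest : ∀ j → ι (suc j Subset.∈? (s ∷ p)) ≡ ι (j Subset.∈? p)
  rest j = ι-cong (suc j Subset.∈? (s ∷ p)) (j Subset.∈? p) (mk⇔ Subset.drop-there there)
  first : ∀ s → ι (zero Subset.∈? (s ∷ p)) + Subset.∣ p ∣ ≡ Subset.∣ s ∷ p ∣
  first true  = refl
  first false = refl

∣∣≡∑∑ : (A : VertexSet n m) → ∣ A ∣ ≡ ∑[ i < m ] ∑[ j < n ] ι ((j , i) ∈? A)
∣∣≡∑∑ []      = refl
∣∣≡∑∑ (p ∷ A) = cong₂ _+_ (sym (∑-ι-∈ p)) (∣∣≡∑∑ A)

rowCount : VertexSet n m → Fin m → ℕ
rowCount {n} A i = ∑[ j < n ] ι ((j , i) ∈? A)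

colCount : VertexSet n m → Fin n → ℕ
colCount {m = m} A j = ∑[ i < m ] ι ((j , i) ∈? A)

∣∣≡∑rowCount : (A : VertexSet n m) → ∣ A ∣ ≡ ∑ (rowCount A)
∣∣≡∑rowCount = ∣∣≡∑∑

∣∣≡∑colCount : (A : VertexSet n m) → ∣ A ∣ ≡ ∑ (colCount A)
∣∣≡∑colCount A = trans (∣∣≡∑∑ A) (∑-comm λ i j → ι ((j , i) ∈? A))

module _ {P : Pred (R n m) 0ℓ} (P? : Decidable P) where

  private
    entry : ∀ j i → lookup (lookup ⟦ P? ⟧ i) j ≡ does (P? (j , i))
    entry j i = trans (cong (λ p → lookup p j) (Vec.lookup∘tabulate _ i)) (Vec.lookup∘tabulate _ j)

  ∈⟦⟧⁺ : ∀ v → P v → v ∈ ⟦ P? ⟧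
  ∈⟦⟧⁺ (j , i) pv =
    Vec.lookup⇒[]= j (lookup ⟦ P? ⟧ i) (trans (entry j i) (dec-true (P? (j , i)) pv))

  ∈⟦⟧⁻ : ∀ v → v ∈ ⟦ P? ⟧ → P v
  ∈⟦⟧⁻ (j , i) v∈ with P? (j , i) | trans (sym (entry j i)) (Vec.[]=⇒lookup v∈)
  ... | yes pv | _ = pv

∈-∩ : (A B : VertexSet n m) → ∀ v → v ∈ A ∩ B ⇔ (v ∈ A × v ∈ B)
∈-∩ A B (j , i) rewrite Vec.lookup-zipWith Subset._∩_ i A B = Subset.∩⇔×

∈-∪ : (A B : VertexSet n m) → ∀ v → v ∈ A ∪ B ⇔ (v ∈ A ⊎ v ∈ B)
∈-∪ A B (j , i) rewrite Vec.lookup-zipWith Subset._∪_ i A B = Subset.∪⇔⊎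

module _ (A : VertexSet n m) (j : Fin n) (i : Fin m) (v∉A : ¬ (j , i) ∈ A) where

  open ≡-Reasoning

  -- All rows of the intersection except row `i` are empty, so `∑-single` leaves only that one.
  ∣𝒩ʳ∩∣ : ∣ 𝒩ʳ (j , i) ∩ A ∣ ≡ rowCount A i
  ∣𝒩ʳ∩∣ = begin
    ∣ B ∣          ≡⟨ ∣∣≡∑rowCount B ⟩
    ∑ (rowCount B) ≡⟨ ∑-single (rowCount B) i (λ i′ i′≢i → ∑-zero {n} _ λ j′ →
                        ι-no ((j′ , i′) ∈? B) (i′≢i ∘ same-row j′ i′)) ⟩
    rowCount B i   ≡⟨ sum-cong-≗ {n} (λ j′ → ι-cong ((j′ , i) ∈? B) ((j′ , i) ∈? A)
                        (mk⇔ (proj₂ ∘ to (∈B j′ i)) (A⇒B j′))) ⟩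
    rowCount A i   ∎
    where
    N? : Decidable λ ((j′ , i′) : R n m) → ¬ j′ ≡ j × i′ ≡ i
    N? (j′ , i′) = ¬? (j′ Fin.≟ j) ×-dec (i′ Fin.≟ i)
    B = 𝒩ʳ (j , i) ∩ A
    ∈B : ∀ j′ i′ → (j′ , i′) ∈ B ⇔ ((j′ , i′) ∈ 𝒩ʳ (j , i) × (j′ , i′) ∈ A)
    ∈B j′ i′ = ∈-∩ (𝒩ʳ (j , i)) A (j′ , i′)
    same-row : ∀ j′ i′ → (j′ , i′) ∈ B → i′ ≡ i
    same-row j′ i′ v∈B = proj₂ (∈⟦⟧⁻ N? (j′ , i′) (proj₁ (to (∈B j′ i′) v∈B)))
    A⇒B : ∀ j′ → (j′ , i) ∈ A → (j′ , i) ∈ B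
    A⇒B j′ v∈A = from (∈B j′ i) (∈⟦⟧⁺ N? (j′ , i) ((λ { refl → v∉A v∈A }) , refl) , v∈A)

  ∣𝒩ᶜ∩∣ : ∣ 𝒩ᶜ (j , i) ∩ A ∣ ≡ colCount A j
  ∣𝒩ᶜ∩∣ = begin
    ∣ B ∣          ≡⟨ ∣∣≡∑colCount B ⟩
    ∑ (colCount B) ≡⟨ ∑-single (colCount B) j (λ j′ j′≢j → ∑-zero {m} _ λ i′ →
                        ι-no ((j′ , i′) ∈? B) (j′≢j ∘ same-col j′ i′)) ⟩
    colCount B j   ≡⟨ sum-cong-≗ {m} (λ i′ → ι-cong ((j , i′) ∈? B) ((j , i′) ∈? A)
                        (mk⇔ (proj₂ ∘ to (∈B j i′)) (A⇒B i′))) ⟩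
    colCount A j   ∎
    where
    N? : Decidable λ ((j′ , i′) : R n m) → j′ ≡ j × ¬ i′ ≡ i
    N? (j′ , i′) = (j′ Fin.≟ j) ×-dec ¬? (i′ Fin.≟ i)
    B = 𝒩ᶜ (j , i) ∩ A
    ∈B : ∀ j′ i′ → (j′ , i′) ∈ B ⇔ ((j′ , i′) ∈ 𝒩ᶜ (j , i) × (j′ , i′) ∈ A)
    ∈B j′ i′ = ∈-∩ (𝒩ᶜ (j , i)) A (j′ , i′)
    same-col : ∀ j′ i′ → (j′ , i′) ∈ B → j′ ≡ j
    same-col j′ i′ v∈B = proj₁ (∈⟦⟧⁻ N? (j′ , i′) (proj₁ (to (∈B j′ i′) v∈B)))
    A⇒B : ∀ i′ → (j , i′) ∈ A → (j , i′) ∈ B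
    A⇒B i′ v∈A = from (∈B j i′) (∈⟦⟧⁺ N? (j , i′) (refl , (λ { refl → v∉A v∈A })) , v∈A)

-- 𝒩ʳ v and 𝒩ᶜ v omit v itself, but for v ∉ A this does not change the counts.
∈-𝒯 : ∀ Z (A : VertexSet n m) j i →
      (j , i) ∈ 𝒯 Z A ⇔ ((j , i) ∈ A ⊎ ¬ Member Z (rowCount A i , colCount A j))
∈-𝒯 Z A j i = mk⇔ fwd bwd
  where
  new? : Decidable λ v → ¬ v ∈ A × ¬ Member Z (∣ 𝒩ʳ v ∩ A ∣ , ∣ 𝒩ᶜ v ∩ A ∣)
  new? v = ¬? (v ∈? A) ×-dec ¬? (member? Z (∣ 𝒩ʳ v ∩ A ∣ , ∣ 𝒩ᶜ v ∩ A ∣))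
  fwd : (j , i) ∈ 𝒯 Z A → _
  fwd v∈𝒯 with to (∈-∪ A ⟦ new? ⟧ (j , i)) v∈𝒯
  ... | inj₁ v∈A = inj₁ v∈A
  ... | inj₂ v∈new with ∈⟦⟧⁻ new? (j , i) v∈new
  ...   | v∉A , ∉Z = inj₂ (subst (¬_ ∘ Member Z) (cong₂ _,_ (∣𝒩ʳ∩∣ A j i v∉A) (∣𝒩ᶜ∩∣ A j i v∉A)) ∉Z)
  bwd : _ → (j , i) ∈ 𝒯 Z A
  bwd e with (j , i) ∈? A | e
  ... | yes v∈A | _        = 𝒯-increasing Z A _ v∈A
  ... | no  v∉A | inj₁ v∈A = contradiction v∈A v∉A
  ... | no  v∉A | inj₂ ∉Z  = from (∈-∪ A ⟦ new? ⟧ (j , i)) (inj₂ (∈⟦⟧⁺ new? _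
    (v∉A , subst (¬_ ∘ Member Z) (sym (cong₂ _,_ (∣𝒩ʳ∩∣ A j i v∉A) (∣𝒩ᶜ∩∣ A j i v∉A))) ∉Z)))

-- Zero-sets

-- Swapping coordinates turns columns into rows, so that `bottom-row` also describes the leftmost
-- column.
transpose : ZeroSet → ZeroSet
transpose Z .Member     = Member Z ∘ Product.swap
transpose Z .member?    = member? Z ∘ Product.swap
transpose Z .downClosed = downClosed Z ∘ Product.swap

transpose-finite : ∀ Z → Finite (Member Z) → Finite (Member (transpose Z))
transpose-finite Z (ps , ps≡Z) =
  List.map Product.swap ps , λ p → mk⇔
    (λ p∈ → case List.∈-map⁻ Product.swap p∈ of λ { (q , q∈ps , refl) → to (ps≡Z q) q∈ps })
    (λ p∈Z → List.∈-map⁺ Product.swap (from (ps≡Z (Product.swap p)) p∈Z))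

-- Two duplicate-free lists with the same elements are permutations of each other.
HasSize-unique : {A : Set} {P : Pred A 0ℓ} → HasSize P k → HasSize P l → k ≡ l
HasSize-unique (xs , xs! , xs≡P , refl) (ys , ys! , ys≡P , refl) =
  ↭-length (∼bag⇒↭ (unique∧set⇒bag xs! ys! λ {x} → ⇔-sym (ys≡P x) ⇔-∘ xs≡P x))

row-bounded : ∀ Z → Finite (Member Z) → ∃[ c ] (∀ y → ¬ row Z y c)
-- `suc c` exceeds the first coordinate of every listed point.
row-bounded Z (ps , ps≡Z) = suc c , λ y c∈Z →
  <-irrefl refl (All.lookup (xs≤max 0 (List.map proj₁ ps))
    (List.∈-map⁺ proj₁ (from (ps≡Z (suc c , y)) c∈Z)))
  where c = max 0 (List.map proj₁ ps)

-- Here `k` is the least point missing from the row: minimality puts everything below it in the row,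
-- and downward closure keeps everything from it onwards out.
row-initial : ∀ Z → Finite (Member Z) → ∀ y → ∃[ k ] (∀ x → row Z y x ⇔ x < k)
row-initial Z fin y =
  let c , c∉Z = row-bounded Z fin
      k , k∉Z , k-min = minimum (λ x → ¬? (member? Z (x , y))) (c , c∉Z y)
  in k , λ x → mk⇔
       (λ x∈Z → ≰⇒> λ k≤x → k∉Z (downClosed Z (k≤x , ≤-refl) x∈Z))
       (λ x<k → decidable-stable (member? Z (x , y)) λ x∉Z → <⇒≱ x<k (k-min x x∉Z))

initial-HasSize : {P : Pred ℕ 0ℓ} → (∀ x → P x ⇔ x < k) → HasSize P k
initial-HasSize {k} P≡<k =
  upTo k , Unique.upTo⁺ k
  , (λ x → mk⇔ (from (P≡<k x) ∘ List.∈-upTo⁻) (List.∈-upTo⁺ ∘ to (P≡<k x)))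
  , List.length-upTo k

-- By downward closure row 0 contains every other row, so it attains the maximal size; as an initial
-- segment it is then determined by `a`.
bottom-row : ∀ Z {a} → Finite (Member Z) → LongestRowSize Z a → ∀ x → row Z 0 x ⇔ x < a
bottom-row Z {a} fin ((y , size-a) , longest) x =
  subst (λ k → row Z 0 x ⇔ x < k) (≤-antisym k₀≤a a≤k₀) (row₀ x)
  where
  k₀ = proj₁ (row-initial Z fin 0)
  row₀ = proj₂ (row-initial Z fin 0)
  kᵧ = proj₁ (row-initial Z fin y)
  rowᵧ = proj₂ (row-initial Z fin y)
  k₀≤a : k₀ ≤ a
  k₀≤a = longest k₀ (0 , initial-HasSize row₀)
  kᵧ≤k₀ : kᵧ ≤ k₀
  kᵧ≤k₀ = ≮⇒≥ λ k₀<kᵧ →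
    <-irrefl refl (to (row₀ k₀) (downClosed Z (≤-refl , z≤n) (from (rowᵧ k₀) k₀<kᵧ)))
  a≤k₀ : a ≤ k₀
  a≤k₀ = subst (_≤ k₀) (HasSize-unique (initial-HasSize rowᵧ) size-a) kᵧ≤k₀

-- Move left from (X , Y) as far as possible outside Z, then down. A point q outside Z below the
-- result still lies outside after being raised to height Y, so it cannot be further left; then it
-- cannot be lower either.
corner-below : ∀ Z X Y → ¬ Member Z (X , Y) →
               ∃[ x ] ∃[ y ] ConcaveCorner Z (x , y) × x ≤ X × y ≤ Y
corner-below Z X Y XY∉Z =
  let x , xY∉Z , x-min = minimum (λ x → ¬? (member? Z (x , Y))) (X , XY∉Z)
      y , xy∉Z , y-min = minimum (λ y → ¬? (member? Z (x , y))) (Y , xY∉Z)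
      y≤Y = y-min Y xY∉Z
  in x , y
   , (xy∉Z , λ { (q₁ , q₂) q∉Z (q₁≤x , q₂≤y) →
       let q₁≡x = ≤-antisym q₁≤x
                    (x-min q₁ (q∉Z ∘ downClosed Z (≤-refl , ≤-trans q₂≤y y≤Y)))
       in cong₂ _,_ q₁≡x (≤-antisym q₂≤y (y-min q₂ (subst (λ q → ¬ Member Z (q , q₂)) q₁≡x q∉Z))) })
   , x-min X XY∉Z , y≤Y

-- Corners in the bounding box and the upper bound

module _ (Z : ZeroSet) {a b : ℕ}
         (row₀ : ∀ x → Member Z (x , 0) ⇔ x < a)
         (col₀ : ∀ y → Member Z (0 , y) ⇔ y < b)
  where

  row<a : ∀ {x y} → Member Z (x , y) → x < a
  row<a ∈Z = to (row₀ _) (downClosed Z (≤-refl , z≤n) ∈Z)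

  col<b : ∀ {x y} → Member Z (x , y) → y < b
  col<b ∈Z = to (col₀ _) (downClosed Z (z≤n , ≤-refl) ∈Z)

  -- If x exceeded a, then (a , y) would be a strictly smaller point outside Z; similarly (x , b) if
  -- y exceeded b.
  corner-≤ : ∀ {x y} → ConcaveCorner Z (x , y) → x ≤ a × y ≤ b
  corner-≤ {x} {y} (_ , minimal) =
      ≮⇒≥ (λ a<x → <⇒≢ a<x (cong proj₁ (minimal (a , y) (<-irrefl refl ∘ row<a) (<⇒≤ a<x , ≤-refl))))
    , ≮⇒≥ (λ b<y → <⇒≢ b<y (cong proj₂ (minimal (x , b) (<-irrefl refl ∘ col<b) (≤-refl , <⇒≤ b<y))))

  bottom-corner : ∃[ x ] ConcaveCorner Z (x , 0) × x ≤ a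
  bottom-corner with corner-below Z a 0 (<-irrefl refl ∘ to (row₀ a))
  ... | x , .0 , corner , x≤a , z≤n = x , corner , x≤a

  -- a vanishes exactly when b does, so that the hypotheses m, n > a b give room for
  -- a full row and a full column.
  a,b≤ab : a ≤ a * b × b ≤ a * b
  a,b≤ab with a ≟ 0 | b ≟ 0
  ... | yes refl | yes refl = z≤n , z≤n
  ... | yes refl | no b≢0   = contradiction (to (row₀ 0) (from (col₀ 0) (n≢0⇒n>0 b≢0))) λ ()
  ... | no a≢0   | yes refl = contradiction (to (col₀ 0) (from (row₀ 0) (n≢0⇒n>0 a≢0))) λ ()
  ... | no a≢0   | no b≢0   = m≤m*n a b {{≢-nonZero b≢0}} , m≤n*m b a {{≢-nonZero a≢0}}

  corner-spans : ∀ {x y} → ConcaveCorner Z (x , y) → a ≤ n → b ≤ m →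
                 ∃[ A ] SpansInTwoSteps {n} {m} Z A × ∣ A ∣ ≤ b * x + a * y ∸ x * y
  corner-spans {n} {m} {x} {y} corner a≤n b≤m = A , spans , size
    where
    x≤a = proj₁ (corner-≤ corner)
    y≤b = proj₂ (corner-≤ corner)

    C? : ∀ (v : R n m) → Dec (toℕ (proj₂ v) < b × toℕ (proj₁ v) < x)
    C? (j , i) = (toℕ i <? b) ×-dec (toℕ j <? x)
    D? : ∀ (v : R n m) → Dec (toℕ (proj₂ v) < y × toℕ (proj₁ v) < a)
    D? (j , i) = (toℕ i <? y) ×-dec (toℕ j <? a)

    A : VertexSet n m
    A = ⟦ (λ v → C? v ⊎-dec D? v) ⟧

    ∈A : ∀ v → _ → v ∈ A
    ∈A = ∈⟦⟧⁺ (λ v → C? v ⊎-dec D? v)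

    -- Column `j` holds at least `b` points of `A`, while points of Z have second coordinate below
    -- `b`; hence the whole column is filled, whatever the row counts.
    column∈𝒯 : ∀ j i → toℕ j < x → (j , i) ∈ 𝒯 Z A
    column∈𝒯 j i j<x = from (∈-𝒯 Z A j i) (inj₂ λ ∈Z → <⇒≱ (col<b ∈Z)
      (subst (_≤ colCount A j) (∑-ι-< b≤m) (∑-mono {m} λ i′ →
        ι-mono (toℕ i′ <? b) ((j , i′) ∈? A) λ i′<b → ∈A (j , i′) (inj₁ (i′<b , j<x)))))

    row∈𝒯 : ∀ j i → toℕ i < y → (j , i) ∈ 𝒯 Z A
    row∈𝒯 j i i<y = from (∈-𝒯 Z A j i) (inj₂ λ ∈Z → <⇒≱ (row<a ∈Z)
      (subst (_≤ rowCount A i) (∑-ι-< a≤n) (∑-mono {n} λ j′ →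
        ι-mono (toℕ j′ <? a) ((j′ , i) ∈? A) λ j′<a → ∈A (j′ , i) (inj₂ (i<y , j′<a)))))

    spans : SpansInTwoSteps Z A
    spans (j , i) = from (∈-𝒯 Z (𝒯 Z A) j i) (inj₂ (proj₁ corner ∘ downClosed Z (x≤ , y≤)))
      where
      x≤ : x ≤ rowCount (𝒯 Z A) i
      x≤ = subst (_≤ rowCount (𝒯 Z A) i) (∑-ι-< (≤-trans x≤a a≤n)) (∑-mono {n} λ j′ →
             ι-mono (toℕ j′ <? x) ((j′ , i) ∈? 𝒯 Z A) (column∈𝒯 j′ i))
      y≤ : y ≤ colCount (𝒯 Z A) j
      y≤ = subst (_≤ colCount (𝒯 Z A) j) (∑-ι-< (≤-trans y≤b b≤m)) (∑-mono {m} λ i′ →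
             ι-mono (toℕ i′ <? y) ((j , i′) ∈? 𝒯 Z A) (row∈𝒯 j i′))

    block : ∀ {k l} → k ≤ m → l ≤ n →
            ∑[ i < m ] ∑[ j < n ] ι ((toℕ i <? k) ×-dec (toℕ j <? l)) ≡ k * l
    block {k} {l} k≤m l≤n = begin
      ∑[ i < m ] ∑[ j < n ] ι ((toℕ i <? k) ×-dec (toℕ j <? l))
        ≡⟨ sum-cong-≗ {m} (λ i → sum-cong-≗ {n} λ j → ι-× (toℕ i <? k) (toℕ j <? l)) ⟩
      ∑[ i < m ] ∑[ j < n ] (ι (toℕ i <? k) * ι (toℕ j <? l))
        ≡⟨ ∑-* {m} {n} (λ i → ι (toℕ i <? k)) (λ j → ι (toℕ j <? l)) ⟩
      (∑[ i < m ] ι (toℕ i <? k)) * (∑[ j < n ] ι (toℕ j <? l))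
        ≡⟨ cong₂ _*_ (∑-ι-< k≤m) (∑-ι-< l≤n) ⟩
      k * l ∎
      where open ≡-Reasoning

    -- Since x ≤ a and y ≤ b, the rectangle [0,x) × [0,y) lies in both pieces of `A`, so its points
    -- count twice on the right.
    pointwise : ∀ i j → ι ((toℕ i <? y) ×-dec (toℕ j <? x)) + ι ((j , i) ∈? A)
                        ≤ ι (C? (j , i)) + ι (D? (j , i))
    pointwise i j = begin
      ι ((toℕ i <? y) ×-dec (toℕ j <? x)) + ι ((j , i) ∈? A)
        ≤⟨ +-mono-≤
             (ι-mono ((toℕ i <? y) ×-dec (toℕ j <? x)) (C? v ×-dec D? v)
               λ (i<y , j<x) → (<-≤-trans i<y y≤b , j<x) , (i<y , <-≤-trans j<x x≤a))
             (ι-mono (v ∈? A) (C? v ⊎-dec D? v) (∈⟦⟧⁻ (λ v → C? v ⊎-dec D? v) v)) ⟩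
      ι (C? v ×-dec D? v) + ι (C? v ⊎-dec D? v)  ≡⟨ +-comm (ι (C? v ×-dec D? v)) _ ⟩
      ι (C? v ⊎-dec D? v) + ι (C? v ×-dec D? v)  ≡⟨ ι-⊎-× (C? v) (D? v) ⟩
      ι (C? v) + ι (D? v)  ∎
      where
      open ≤-Reasoning
      v = j , i

    size : ∣ A ∣ ≤ b * x + a * y ∸ x * y
    -- Truncated subtraction is avoided by adding `x * y` to `∣ A ∣` and comparing sums over the
    -- grid.
    size = m+n≤o⇒m≤o∸n ∣ A ∣ (begin
      ∣ A ∣ + x * y
        ≡⟨ +-comm ∣ A ∣ (x * y) ⟩
      x * y + ∣ A ∣
        ≡⟨ cong₂ _+_ (trans (*-comm x y) (sym (block (≤-trans y≤b b≤m) (≤-trans x≤a a≤n)))) (∣∣≡∑∑ A) ⟩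
      ∑[ i < m ] ∑[ j < n ] ι ((toℕ i <? y) ×-dec (toℕ j <? x)) + ∑[ i < m ] ∑[ j < n ] ι ((j , i) ∈? A)
        ≡⟨ ∑∑-+ (λ i j → ι ((toℕ i <? y) ×-dec (toℕ j <? x))) (λ i j → ι ((j , i) ∈? A)) ⟨
      ∑[ i < m ] ∑[ j < n ] (ι ((toℕ i <? y) ×-dec (toℕ j <? x)) + ι ((j , i) ∈? A))
        ≤⟨ ∑-mono₂ {m} {n} pointwise ⟩
      ∑[ i < m ] ∑[ j < n ] (ι (C? (j , i)) + ι (D? (j , i)))
        ≡⟨ ∑∑-+ (λ i j → ι (C? (j , i))) (λ i j → ι (D? (j , i))) ⟩
      ∑[ i < m ] ∑[ j < n ] ι (C? (j , i)) + ∑[ i < m ] ∑[ j < n ] ι (D? (j , i))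
        ≡⟨ cong₂ _+_ (block b≤m (≤-trans x≤a a≤n)) (trans (block (≤-trans y≤b b≤m) a≤n) (*-comm y a)) ⟩
      b * x + a * y ∎)
      where
      open ≤-Reasoning

-- The lower bound

-- The weights `s` select indices where `f` is at least `k`; each selected index contributes at
-- least `k` on the right.
weighted-≤ : (f s : Fin n → ℕ) → (∀ i → s i ≤ ι (k ≤? f i)) → k * ∑ s ≤ ∑[ i < n ] (s i * f i)
weighted-≤ {n} {k} f s s≤ι = begin
  k * ∑ s              ≡⟨ *-distribˡ-sum k s ⟩
  ∑[ i < n ] (k * s i) ≤⟨ ∑-mono {n} term ⟩
  ∑[ i < n ] (s i * f i) ∎
  where
  open ≤-Reasoning
  term : ∀ i → k * s i ≤ s i * f i
  term i with k ≤? f i | s≤ι i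
  ... | yes k≤fi | _    = subst (_≤ s i * f i) (*-comm (s i) k) (*-monoʳ-≤ (s i) k≤fi)
  ... | no  _    | si≤0 rewrite n≤0⇒n≡0 si≤0 | *-zeroʳ k = z≤n

-- Read s, t and e as indicators of a chosen column, a chosen row and a point of A. The left side
-- counts the point twice only at a crossing of chosen lines, where `s * t` pays for the surplus.
overlap-≤ : ∀ {s t e} → s ≤ 1 → t ≤ 1 → e ≤ 1 → s * e + t * e ≤ e + s * t
overlap-≤ {t = t} {e} z≤n t≤1 e≤1 =
  ≤-trans (*-monoˡ-≤ e t≤1) (≤-reflexive (trans (+-identityʳ e) (sym (+-identityʳ e))))
overlap-≤ {t = t} {e} (s≤s z≤n) t≤1 e≤1 =
  +-mono-≤ (≤-reflexive (+-identityʳ e))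
           (≤-trans (*-monoʳ-≤ t e≤1) (≤-reflexive (*-comm t 1)))

-- Count the points of `A` on the chosen columns and on the chosen rows. Points counted twice lie at
-- crossings, and there are `∑ s * ∑ t` of these.
lines-≤-∣∣ : ∀ {a b} (A : VertexSet n m) (s : Fin n → ℕ) (t : Fin m → ℕ) →
             (∀ j → s j ≤ ι (b ≤? colCount A j)) → (∀ i → t i ≤ ι (a ≤? rowCount A i)) →
             b * ∑ s + a * ∑ t ≤ ∣ A ∣ + ∑ s * ∑ t
lines-≤-∣∣ {n} {m} {a} {b} A s t s≤ t≤ = begin
  b * ∑ s + a * ∑ t
    ≤⟨ +-mono-≤ (weighted-≤ (colCount A) s s≤) (weighted-≤ (rowCount A) t t≤) ⟩
  ∑[ j < n ] (s j * colCount A j) + ∑[ i < m ] (t i * rowCount A i)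
    ≡⟨ cong₂ _+_
         (trans (sum-cong-≗ {n} λ j → *-distribˡ-sum (s j) (λ i → e i j)) (∑-comm λ j i → s j * e i j))
         (sum-cong-≗ {m} λ i → *-distribˡ-sum (t i) (e i)) ⟩
  ∑[ i < m ] ∑[ j < n ] (s j * e i j) + ∑[ i < m ] ∑[ j < n ] (t i * e i j)
    ≡⟨ ∑∑-+ (λ i j → s j * e i j) (λ i j → t i * e i j) ⟨
  ∑[ i < m ] ∑[ j < n ] (s j * e i j + t i * e i j)
    ≤⟨ ∑-mono₂ {m} {n} (λ i j → overlap-≤ (≤-trans (s≤ j) (ι≤1 (b ≤? colCount A j)))
                                          (≤-trans (t≤ i) (ι≤1 (a ≤? rowCount A i)))
                                          (ι≤1 ((j , i) ∈? A))) ⟩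
  ∑[ i < m ] ∑[ j < n ] (e i j + s j * t i)
    ≡⟨ ∑∑-+ e (λ i j → s j * t i) ⟩
  ∑[ i < m ] ∑[ j < n ] e i j + ∑[ i < m ] ∑[ j < n ] (s j * t i)
    ≡⟨ cong₂ _+_ (sym (∣∣≡∑∑ A)) (trans (∑-comm λ i j → s j * t i) (∑-* s t)) ⟩
  ∣ A ∣ + ∑ s * ∑ t ∎
  where
  open ≤-Reasoning
  e : Fin m → Fin n → ℕ
  e i j = ι ((j , i) ∈? A)

module _ (Z : ZeroSet) {a b : ℕ}
         (row₀ : ∀ x → Member Z (x , 0) ⇔ x < a)
         (col₀ : ∀ y → Member Z (0 , y) ⇔ y < b)
  where

  -- On an empty row the first step only adds vertices whose column has b points of A,
  -- and likewise on an empty column.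
  full-lines∉Z : (A : VertexSet n m) → SpansInTwoSteps Z A → ∣ A ∣ < m → ∣ A ∣ < n →
                 ¬ Member Z (∑[ j < n ] ι (b ≤? colCount A j) , ∑[ i < m ] ι (a ≤? rowCount A i))
  full-lines∉Z {n} {m} A spans ∣A∣<m ∣A∣<n
    with ∑<n⇒∃≡0 (rowCount A) (subst (_< m) (∣∣≡∑rowCount A) ∣A∣<m)
       | ∑<n⇒∃≡0 (colCount A) (subst (_< n) (∣∣≡∑colCount A) ∣A∣<n)
  ... | i₀ , row-empty | j₀ , col-empty =
    case to (∈-𝒯 Z (𝒯 Z A) j₀ i₀) (spans (j₀ , i₀)) of λ
      { (inj₁ v∈𝒯A) → case to (∈-𝒯 Z A j₀ i₀) v∈𝒯A of λ
          { (inj₁ v∈A) → contradiction v∈A (∉row j₀)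
          -- Filled already in the first step, the crossing vertex has counts (0 , 0). These lie
          -- outside Z, and so does every larger pair.
          ; (inj₂ ∉Z)  → ∉Z ∘ downClosed Z
              (subst (_≤ _) (sym row-empty) z≤n , subst (_≤ _) (sym col-empty) z≤n) }
      ; (inj₂ ∉Z) → ∉Z ∘ downClosed Z
          ( ∑-mono {n} (λ j → ι-mono ((j , i₀) ∈? 𝒯 Z A) (b ≤? colCount A j) (in-row j))
          , ∑-mono {m} (λ i → ι-mono ((j₀ , i) ∈? 𝒯 Z A) (a ≤? rowCount A i) (in-col i))) }
    where
    ∉row : ∀ j → ¬ (j , i₀) ∈ A
    ∉row j = ι≡0⇒¬ ((j , i₀) ∈? A) (∑≡0⇒≡0 {n} _ row-empty j)
    ∉col : ∀ i → ¬ (j₀ , i) ∈ A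
    ∉col i = ι≡0⇒¬ ((j₀ , i) ∈? A) (∑≡0⇒≡0 {m} _ col-empty i)
    in-row : ∀ j → (j , i₀) ∈ 𝒯 Z A → b ≤ colCount A j
    in-row j ∈𝒯A with to (∈-𝒯 Z A j i₀) ∈𝒯A
    ... | inj₁ ∈A = contradiction ∈A (∉row j)
    ... | inj₂ ∉Z rewrite row-empty = ≮⇒≥ (∉Z ∘ from (col₀ _))
    in-col : ∀ i → (j₀ , i) ∈ 𝒯 Z A → a ≤ rowCount A i
    in-col i ∈𝒯A with to (∈-𝒯 Z A j₀ i) ∈𝒯A
    ... | inj₁ ∈A = contradiction ∈A (∉col i)
    ... | inj₂ ∉Z rewrite col-empty = ≮⇒≥ (∉Z ∘ from (row₀ _))

  spans⇒corner : (A : VertexSet n m) → SpansInTwoSteps Z A → ∣ A ∣ < m → ∣ A ∣ < n →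
                 ∃[ x ] ∃[ y ] ConcaveCorner Z (x , y) × b * x + a * y ∸ x * y ≤ ∣ A ∣
  spans⇒corner A spans ∣A∣<m ∣A∣<n =
    let x , y , corner , x≤X , y≤Y = corner-below Z _ _ (full-lines∉Z A spans ∣A∣<m ∣A∣<n)
        -- Exactly x columns and y rows are kept, because b X + a Y - X Y is not monotone: it
        -- decreases in X once Y exceeds b.
        s , s≤ , ∑s≡x = ∑-lower _ x≤X
        t , t≤ , ∑t≡y = ∑-lower _ y≤Y
    in x , y , corner , m≤n+o⇒m∸n≤o _ (x * y)
         (subst₂ (λ x y → b * x + a * y ≤ x * y + ∣ A ∣) ∑s≡x ∑t≡y
           (subst (b * ∑ s + a * ∑ t ≤_) (+-comm ∣ A ∣ _) (lines-≤-∣∣ A s t s≤ t≤)))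

-- The two bounds combined

-- Phrased for an arbitrary minimum `γ` of the spanning sizes; `γ²` is one by `γ²-minimum`.
minimum-corner :
    (Z : ZeroSet) → Finite (Member Z) →
    (a b : ℕ) → LongestRowSize Z a → LongestColumnSize Z b →
    (m n : ℕ) → m > a * b → n > a * b →
    ∀ γ → IsMinimum (SpanningSize Z m n) γ →
    IsMinimum (λ k → ∃[ x ] ∃[ y ] ConcaveCorner Z (x , y) × k ≡ b * x + a * y ∸ x * y) γ
minimum-corner Z fin a b longest-row longest-col m n m>ab n>ab γ ((A , spans , ∣A∣≡γ) , γ-min) =
  attained , λ { _ (x , y , corner , refl) → γ≤ corner }
  where
  row₀ : ∀ x → Member Z (x , 0) ⇔ x < a
  row₀ = bottom-row Z fin longest-row
  col₀ : ∀ y → Member Z (0 , y) ⇔ y < b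
  col₀ = bottom-row (transpose Z) (transpose-finite Z fin) longest-col

  spans⇒γ≤ : ∀ {k} → ∃[ B ] SpansInTwoSteps {n} {m} Z B × ∣ B ∣ ≤ k → γ ≤ k
  spans⇒γ≤ (B , B-spans , ∣B∣≤k) = ≤-trans (γ-min ∣ B ∣ (B , B-spans , refl)) ∣B∣≤k

  γ≤ : ∀ {x y} → ConcaveCorner Z (x , y) → γ ≤ b * x + a * y ∸ x * y
  γ≤ corner =
    let a≤ab , b≤ab = a,b≤ab Z row₀ col₀
    in spans⇒γ≤ (corner-spans Z row₀ col₀ corner
         (<⇒≤ (≤-<-trans a≤ab n>ab)) (<⇒≤ (≤-<-trans b≤ab m>ab)))

  -- The corner on the horizontal axis has value b x ≤ a b. With m, n > a b, this makes a minimal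
  -- `A` small enough to miss a row and a column, as the lower bound requires.
  γ≤ab : γ ≤ a * b
  γ≤ab = let x , corner , x≤a = bottom-corner Z row₀ col₀ in begin
    γ                       ≤⟨ γ≤ corner ⟩
    b * x + a * 0 ∸ x * 0   ≤⟨ m∸n≤m _ (x * 0) ⟩
    b * x + a * 0           ≡⟨ trans (cong (b * x +_) (*-zeroʳ a)) (+-identityʳ _) ⟩
    b * x                   ≤⟨ *-monoʳ-≤ b x≤a ⟩
    b * a                   ≡⟨ *-comm b a ⟩
    a * b                   ∎
    where open ≤-Reasoning

  ∣A∣≤ab : ∣ A ∣ ≤ a * b
  ∣A∣≤ab = subst (_≤ a * b) (sym ∣A∣≡γ) γ≤ab

  attained : ∃[ x ] ∃[ y ] ConcaveCorner Z (x , y) × γ ≡ b * x + a * y ∸ x * y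
  attained =
    let x , y , corner , value≤ = spans⇒corner Z row₀ col₀ A spans
          (≤-<-trans ∣A∣≤ab m>ab) (≤-<-trans ∣A∣≤ab n>ab)
    in x , y , corner , ≤-antisym (γ≤ corner) (subst (b * x + a * y ∸ x * y ≤_) ∣A∣≡γ value≤)

lemma8p1 : (Z : ZeroSet) → Finite (Member Z) →
    (a b : ℕ) → LongestRowSize Z a → LongestColumnSize Z b →
    (m n : ℕ) → m > a * b → n > a * b →
    IsMinimum
    (λ k → ∃[ x ] ∃[ y ] ConcaveCorner Z (x , y) × k ≡ b * x + a * y ∸ x * y)
    (γ² Z m n)
lemma8p1 Z fin a b longest-row longest-col m n m>ab n>ab =
  minimum-corner Z fin a b longest-row longest-col m n m>ab n>ab _ (proj₂ (γ²-minimum Z m n))
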